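{- Every finite retract of a sociable graph is sociable.
   Context: A graph is a pair $(V,E)$ where $E$ is a symmetric and reflexive binary relation on $V$ (every vertex has a loop). A homomorphism is an edge-preserving map (it may collapse edges). A retraction of $X$ onto $Y\subseteq X$ is a homomorphism $X\to Y$ (with $Y$ the induced subgraph) that is the identity on $Y$; then $Y$ is a retract of $X$. A (finite or countably infinite) graph $X$ is sociable if $X=\bigcup_{n\in\omega}X_n$ where the $X_n$ are finite induced subgraphs, $|X_0|=1$, $X_n\subseteq X_{n+1}$, $|X_{n+1}\setminus X_n|\leq 1$, and for each $n$ there is a retraction $p_n$ of $X_{n+1}$ onto $X_n$ such that, if $X_{n+1}\setminus X_n=\{w\}$, then $w$ is adjacent to $p_n(w)$. -}

module Defs where

open import Data.Fin.Base using (Fin)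
open import Data.Nat.Base using (ℕ; suc; _≤_)
open import Data.Product.Base using (_×_; ∃-syntax)
open import Data.Refinement.Base using (Refinement; value)
open import Data.Sum.Base using (_⊎_)
open import Function.Base using (_∘_)
open import Function.Bundles using (_↔_)
open import Level using (0ℓ)
open import Relation.Binary.Core using (Rel)
open import Relation.Binary.Definitions using (Reflexive; Symmetric)
open import Relation.Binary.PropositionalEquality using (_≡_)
open import Relation.Unary using (Pred; _⊆_; _≐_; _∈_; ∁; ｛_｝)

record Graph : Set₁ where
  field
    Vertex  : Set
    Edge    : Rel Vertex 0ℓ
    E-refl  : Reflexive Edge
    E-sym   : Symmetric Edge

open Graph public

record Hom (G H : Graph) : Set where
  field
    map       : Vertex G → Vertex H
    preserves : ∀ {u v} → Edge G u v → Edge H (map u) (map v)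

open Hom public

-- The induced subgraph.  Membership proofs are irrelevant in a Refinement, so
-- two of its vertices are equal as soon as they are equal in G, and a map out
-- of it cannot depend on how membership was proved.

_[_] : (G : Graph) → Pred (Vertex G) 0ℓ → Graph
G [ P ] = record
  { Vertex = Refinement (Vertex G) P
  ; Edge   = λ u v → Edge G (value u) (value v)
  ; E-refl = E-refl G
  ; E-sym  = E-sym G
  }

record Retraction (G : Graph) (P : Pred (Vertex G) 0ℓ) : Set where
  field
    hom      : Hom G (G [ P ])
    identity : ∀ (y : Vertex (G [ P ])) → map hom (value y) ≡ y

open Retraction public

HasSize : Set → ℕ → Set
HasSize A k = A ↔ Fin k

Finite : Set → Set
Finite A = ∃[ k ] HasSize A k

CountablyInfinite : Set → Set
CountablyInfinite A = A ↔ ℕ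

-- X n is a set of vertices of G, standing for the subgraph G [ X n ] it
-- induces.  Inside G [ X (suc n) ], the vertex set of G [ X n ] is Old n, and
-- ∁ (Old n) is the difference X (suc n) ∖ X n.

record Sociable (G : Graph) : Set₁ where
  field
    countable : Finite (Vertex G) ⊎ CountablyInfinite (Vertex G)
    X         : ℕ → Pred (Vertex G) 0ℓ
    finite    : ∀ n → Finite (Vertex (G [ X n ]))
    union     : ∀ v → ∃[ n ] v ∈ X n
    start     : HasSize (Vertex (G [ X 0 ])) 1
    monotone  : ∀ n → X n ⊆ X (suc n)

  Old : ∀ n → Pred (Vertex (G [ X (suc n) ])) 0ℓ
  Old n = X n ∘ value

  field
    step      : ∀ n → ∃[ k ] k ≤ 1 × HasSize (Refinement (Vertex (G [ X (suc n) ])) (∁ (Old n))) k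
    p         : ∀ n → Retraction (G [ X (suc n) ]) (Old n)
    adjacent  : ∀ n (w : Vertex (G [ X (suc n) ])) → ∁ (Old n) ≐ ｛ w ｝ →
                Edge (G [ X (suc n) ]) w (value (map (hom (p n)) w))

{-# OPTIONS --safe #-}

-- Let r : B → H be a retraction with section i, and let e : B → B fold the
-- single vertex w of B outside A onto a neighbour e w in A.  The endomorphism
-- f = r ∘ e ∘ i of H moves at most the vertex h with i h = w, and
-- h = r w is adjacent to f h = r (e w).  It is idempotent: if f h ≠ h, then
-- i (f h) ≠ w, so f fixes f h.  Hence H folds onto the fixed points of f, and
-- these are a retract of A, with section e ∘ i and retraction f ∘ r.  Starting
-- at a level that contains the whole of H, this gives the required filtration.

module Submission where

open import Defs
open import Data.Empty using (⊥-elim; ⊥-elim-irr)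
open import Data.Fin.Base using (Fin; zero; suc)
import Data.Fin.Properties as Fin
open import Data.Irrelevant as Irrelevant using (Irrelevant) renaming ([_] to irr)
open import Data.Nat.Base using (ℕ; zero; suc; pred; _+_; _∸_; _⊔_; _≤_; z≤n; s≤s)
open import Data.Nat.Properties
  using (≤-trans; ≤-reflexive; +-suc; +-identityʳ; n∸n≡0; m≤n+m∸n; m≤m⊔n; m≤n⊔m;
         pred[m∸n]≡m∸[1+n]; m≤n⇒m<n∨m≡n)
open import Data.Product.Base using (Σ; ∃-syntax; _×_; _,_; proj₁; proj₂)
open import Data.Refinement.Base using (Refinement; value; proof)
  renaming (_,_ to infixr 4 _⸴_)
open import Data.Refinement.Properties using (value-injective) renaming (_≟_ to refinement-≟)
open import Data.Sum.Base using (inj₁; inj₂)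
open import Data.Unit.Base using (tt)
open import Function.Base using (_∘_)
open import Function.Bundles using (mk↔ₛ′; Inverse)
open import Function.Properties.Inverse using (↔⇒↣)
open import Level using (0ℓ)
open import Relation.Binary.Definitions using (DecidableEquality)
open import Relation.Binary.PropositionalEquality
  using (_≡_; _≢_; refl; sym; trans; cong; subst)
open import Relation.Nullary using (yes; no; ¬_)
open import Relation.Nullary.Decidable using (via-injection; decidable-stable; recompute; ¬?; map′)
open import Relation.Unary using (Pred; Decidable; _⊆_; ∁; U)

private
  variable
    A : Set
    G H : Graph

-- Finite types, their decidable subsets, and counting up to one.

finite-≟ : Finite A → DecidableEquality A
finite-≟ (_ , A↔Fin) = via-injection (↔⇒↣ A↔Fin) Fin._≟_

refinement-Fin-finite : ∀ k {P : Pred (Fin k) 0ℓ} → Decidable P → Finite (Refinement (Fin k) P)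
refinement-Fin-finite zero P? = 0 , mk↔ₛ′ (λ ()) (λ ()) (λ ()) (λ ())
refinement-Fin-finite (suc k) {P} P? with P? zero | refinement-Fin-finite k (P? ∘ suc)
... | yes p | j , bij = suc j , mk↔ₛ′ to from to∘from from∘to
  where
  open Inverse bij renaming (to to to′; from to from′)
  to : Refinement (Fin (suc k)) P → Fin (suc j)
  to (zero  ⸴ _) = zero
  to (suc x ⸴ q) = suc (to′ (x ⸴ q))
  from : Fin (suc j) → Refinement (Fin (suc k)) P
  from zero    = zero ⸴ irr p
  from (suc y) = suc (value (from′ y)) ⸴ proof (from′ y)
  to∘from : ∀ y → to (from y) ≡ y
  to∘from zero    = refl
  to∘from (suc y) = cong suc (strictlyInverseˡ y)
  from∘to : ∀ x → from (to x) ≡ x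
  from∘to (zero  ⸴ _) = refl
  from∘to (suc x ⸴ q) = value-injective (cong (suc ∘ value) (strictlyInverseʳ (x ⸴ q)))
... | no ¬p | j , bij = j , mk↔ₛ′ to from strictlyInverseˡ from∘to
  where
  open Inverse bij using (strictlyInverseˡ; strictlyInverseʳ) renaming (to to to′; from to from′)
  to : Refinement (Fin (suc k)) P → Fin j
  to (zero  ⸴ irr p) = ⊥-elim-irr (¬p p)
  to (suc x ⸴ q)     = to′ (x ⸴ q)
  from : Fin j → Refinement (Fin (suc k)) P
  from y = suc (value (from′ y)) ⸴ proof (from′ y)
  from∘to : ∀ x → from (to x) ≡ x
  from∘to (zero  ⸴ irr p) = ⊥-elim-irr (¬p p)
  from∘to (suc x ⸴ q)     = value-injective (cong (suc ∘ value) (strictlyInverseʳ (x ⸴ q)))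

-- Serves twice for the filtration of H: each level, and the set of new vertices at each step, is
-- cut out by a decidable predicate.
refinement-finite : Finite A → {P : Pred A 0ℓ} → Decidable P → Finite (Refinement A P)
refinement-finite {A} (k , bij) {P} P? =
  proj₁ fin , mk↔ₛ′ to′ from′ to∘from from∘to
  where
  open Inverse bij
  fin : Finite (Refinement (Fin k) (P ∘ from))
  fin = refinement-Fin-finite k (P? ∘ from)
  module F = Inverse (proj₂ fin)
  toFin : Refinement A P → Refinement (Fin k) (P ∘ from)
  toFin (a ⸴ p) = to a ⸴ Irrelevant.map (subst P (sym (strictlyInverseʳ a))) p
  to′ : Refinement A P → Fin (proj₁ fin)
  to′ = F.to ∘ toFin
  from′ : Fin (proj₁ fin) → Refinement A P
  from′ y = from (value (F.from y)) ⸴ proof (F.from y)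
  to∘from : ∀ y → to′ (from′ y) ≡ y
  to∘from y = trans (cong F.to (value-injective (strictlyInverseˡ _))) (F.strictlyInverseˡ y)
  from∘to : ∀ x → from′ (to′ x) ≡ x
  from∘to x = value-injective
    (trans (cong (from ∘ value) (F.strictlyInverseʳ (toFin x))) (strictlyInverseʳ (value x)))

subsingleton-size : ∀ {k} → HasSize A k → (∀ (x y : A) → x ≡ y) → k ≤ 1
subsingleton-size {k = 0} _ _ = z≤n
subsingleton-size {k = 1} _ _ = s≤s z≤n
subsingleton-size {k = suc (suc _)} bij eq =
  ⊥-elim (Fin.0≢1+n {i = zero}
    (trans (sym (strictlyInverseˡ zero))
      (trans (cong to (eq (from zero) (from (suc zero)))) (strictlyInverseˡ (suc zero)))))
  where open Inverse bij

size≤1⇒subsingleton : ∀ {k} → k ≤ 1 → HasSize A k → ∀ (x y : A) → x ≡ y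
size≤1⇒subsingleton k≤1 bij x y =
  trans (sym (strictlyInverseʳ x)) (trans (cong from (fin≡ k≤1 (to x) (to y))) (strictlyInverseʳ y))
  where
  open Inverse bij
  fin≡ : ∀ {k} → k ≤ 1 → (i j : Fin k) → i ≡ j
  fin≡ (s≤s z≤n) zero zero = refl

singleton-size : (a : A) → (∀ (x y : A) → x ≡ y) → HasSize A 1
singleton-size a eq = mk↔ₛ′ (λ _ → zero) (λ _ → a) (λ { zero → refl }) (eq a)

Fin-bounded : ∀ {k} (g : Fin k → ℕ) → ∃[ n ] ∀ i → g i ≤ n
Fin-bounded {zero}  g = 0 , λ ()
Fin-bounded {suc k} g with n , g≤n ← Fin-bounded (g ∘ suc) =
  g zero ⊔ n , λ where
    zero    → m≤m⊔n _ _
    (suc i) → ≤-trans (g≤n i) (m≤n⊔m _ _)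

finite-bounded : Finite A → (g : A → ℕ) → ∃[ n ] ∀ a → g a ≤ n
finite-bounded (_ , bij) g with n , g≤n ← Fin-bounded (g ∘ Inverse.from bij) =
  n , λ a → subst (λ b → g b ≤ n) (Inverse.strictlyInverseʳ bij a) (g≤n (Inverse.to bij a))

-- Abstract retracts and single folding steps.

_∘ʰ_ : ∀ {G H K} → Hom H K → Hom G H → Hom G K
g ∘ʰ f = record { map = map g ∘ map f ; preserves = preserves g ∘ preserves f }

-- A section in place of a subset: during the descent, parts of H are embedded in levels of G by
-- maps that need not be inclusions.
record _RetractOf_ (H G : Graph) : Set where
  field
    section         : Hom H G
    retract         : Hom G H
    retract∘section : ∀ h → map retract (map section h) ≡ h

open _RetractOf_

-- One step of a sociable filtration, from the larger set `S` to `S′`. The bound on removed vertices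
-- is kept as uniqueness and becomes a cardinality only in `Z-step`.
record FoldsOnto (H : Graph) (S S′ : Pred (Vertex H) 0ℓ) : Set where
  field
    shrinks    : S′ ⊆ S
    fold       : Retraction (H [ S ]) (S′ ∘ value)
    removes≤1  : ∀ (x y : Vertex (H [ S ])) → ¬ S′ (value x) → ¬ S′ (value y) → x ≡ y
    adjacent   : ∀ (w : Vertex (H [ S ])) → ¬ S′ (value w) →
                 Edge H (value w) (value (value (map (hom fold) w)))

FoldsOnto-refl : ∀ {S} → FoldsOnto H S S
FoldsOnto-refl {H} = record
  { shrinks   = λ s → s
  ; fold      = record
    { hom      = record { map = λ v → v ⸴ proof v ; preserves = λ e → e }
    ; identity = λ _ → refl
    }
  ; removes≤1 = λ { (_ ⸴ irr s) _ ¬s _ → ⊥-elim-irr (¬s s) }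
  ; adjacent  = λ { (_ ⸴ irr s) ¬s → ⊥-elim-irr (¬s s) }
  }

-- Fixed points of an idempotent endomorphism.

module Fixed {H : Graph} (_≟_ : DecidableEquality (Vertex H))
             {S : Pred (Vertex H) 0ℓ} (S? : Decidable S)
             (f : Hom (H [ S ]) (H [ S ]))
             (idem : ∀ h → map f (map f h) ≡ map f h) where

  -- A predicate on all of H, not on `H [ S ]`, so that repeated descents stay among subsets of one
  -- vertex type.
  Fix : Pred (Vertex H) 0ℓ
  Fix v = Σ (S v) λ s → map f (v ⸴ irr s) ≡ (v ⸴ irr s)

  Fix? : Decidable Fix
  Fix? v with S? v
  ... | no ¬s = no (¬s ∘ proj₁)
  ... | yes s = map′ (s ,_) proj₂ (refinement-≟ _≟_ _ _)

  fixed : ∀ h → map f h ≡ h → Irrelevant (Fix (value h))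
  fixed (_ ⸴ irr s) eq = irr (s , eq)

  -- The equation is available only irrelevantly; decidable equality on H recomputes it.
  Fix⇒fixed : ∀ h → Irrelevant (Fix (value h)) → map f h ≡ h
  Fix⇒fixed h (irr q) = recompute (refinement-≟ _≟_ _ _) (proj₂ q)

  ∉Fix⇒moved : ∀ h → ¬ Fix (value h) → map f h ≢ h
  ∉Fix⇒moved (_ ⸴ irr s) ∉Fix eq = ⊥-elim-irr (∉Fix (s , eq))

  restrict : Hom (H [ S ]) (H [ Fix ])
  restrict = record
    { map       = λ h → value (map f h) ⸴ fixed (map f h) (idem h)
    ; preserves = preserves f
    }

  include : Hom (H [ Fix ]) (H [ S ])
  include = record
    { map       = λ h → value h ⸴ Irrelevant.map proj₁ (proof h)
    ; preserves = λ e → e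
    }

  restrict∘include : ∀ h → map restrict (map include h) ≡ h
  restrict∘include h = value-injective (cong value (Fix⇒fixed (map include h) (proof h)))

  -- The fold is `f` itself: idempotence puts its values in `Fix`, and the vertices outside `Fix`
  -- are those that it moves.
  folds : (∀ x y → map f x ≢ x → map f y ≢ y → x ≡ y) →
          (∀ w → map f w ≢ w → Edge (H [ S ]) w (map f w)) →
          FoldsOnto H S Fix
  folds moves≤1 adj = record
    { shrinks   = proj₁
    ; fold      = record
      { hom      = record
        { map       = λ h → map f h ⸴ fixed (map f h) (idem h)
        ; preserves = preserves f
        }
      ; identity = λ y → value-injective (Fix⇒fixed (value y) (proof y))
      }
    ; removes≤1 = λ x y ∉x ∉y → moves≤1 x y (∉Fix⇒moved x ∉x) (∉Fix⇒moved y ∉y)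
    ; adjacent  = λ w ∉w → adj w (∉Fix⇒moved w ∉w)
    }

-- The folding of one level of a sociable graph as an endomorphism.

module Levels {G : Graph} (soc : Sociable G) where
  open Sociable soc public

  X-mono : ∀ {m n} → m ≤ n → X m ⊆ X n
  X-mono {n = zero}  z≤n x = x
  X-mono {n = suc n} m≤n x with m≤n⇒m<n∨m≡n m≤n
  ... | inj₁ (s≤s m≤n′) = monotone n (X-mono m≤n′ x)
  ... | inj₂ refl       = x

  down : ∀ n → Hom (G [ X (suc n) ]) (G [ X n ])
  down n = record
    { map       = λ v → value (value (map (hom (p n)) v)) ⸴ proof (map (hom (p n)) v)
    ; preserves = preserves (hom (p n))
    }

  up : ∀ n → Hom (G [ X n ]) (G [ X (suc n) ])
  up n = record
    { map       = λ v → value v ⸴ Irrelevant.map (monotone n) (proof v)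
    ; preserves = λ e → e
    }

  module _ (n : ℕ) where
    collapse : Hom (G [ X (suc n) ]) (G [ X (suc n) ])
    collapse = up n ∘ʰ down n

    moved⇒new : ∀ v → map collapse v ≢ v → ¬ X n (value v)
    moved⇒new v moved x =
      moved (value-injective (cong (value ∘ value) (identity (p n) (v ⸴ irr x))))

    new≤1 : ∀ v w → ¬ X n (value v) → ¬ X n (value w) → v ≡ w
    new≤1 v w ∉v ∉w with _ , k≤1 , size ← step n =
      cong value (size≤1⇒subsingleton k≤1 size (v ⸴ irr ∉v) (w ⸴ irr ∉w))

    moves≤1 : ∀ v w → map collapse v ≢ v → map collapse w ≢ w → v ≡ w
    moves≤1 v w mv mw = new≤1 v w (moved⇒new v mv) (moved⇒new w mw)

    moved-adjacent : ∀ w → map collapse w ≢ w → Edge (G [ X (suc n) ]) w (map collapse w)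
    -- A moved vertex is new, and new vertices are unique, so the complement of the old level is
    -- exactly the singleton of `w`.
    moved-adjacent w mw = adjacent n w
      ( (λ {v} ∉v → new≤1 w v (moved⇒new w mw) ∉v)
      , (λ { refl → moved⇒new w mw }) )

-- Descent of a finite retract through the levels.

module FiniteRetract {G H : Graph} (soc : Sociable G) (fin : Finite (Vertex H))
                     (ret : H RetractOf G) where
  open Levels soc

  _≟_ : DecidableEquality (Vertex H)
  _≟_ = finite-≟ fin

  record Trace (k : ℕ) : Set₁ where
    field
      Part     : Pred (Vertex H) 0ℓ
      Part?    : Decidable Part
      retracts : (H [ Part ]) RetractOf (G [ X k ])

  open Trace

  module Descent {k} (t : Trace (suc k)) where
    i = section (retracts t)
    r = retract (retracts t)
    e = collapse k

    f : Hom (H [ Part t ]) (H [ Part t ])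
    f = r ∘ʰ (e ∘ʰ i)

    -- If `e` fixes `i h`, then `f h` is `r (i h)`, which is `h`.
    section-moved : ∀ h → map f h ≢ h → map e (map i h) ≢ map i h
    section-moved h moved eq =
      moved (trans (cong (map r) eq) (retract∘section (retracts t) h))

    -- Both sections are moved by `e`, hence equal, and `i` is injective because `r` undoes it.
    f-moves≤1 : ∀ x y → map f x ≢ x → map f y ≢ y → x ≡ y
    f-moves≤1 x y mx my =
      trans (sym (retract∘section (retracts t) x))
        (trans (cong (map r) (moves≤1 k _ _ (section-moved x mx) (section-moved y my)))
          (retract∘section (retracts t) y))

    f-adjacent : ∀ w → map f w ≢ w → Edge (H [ Part t ]) w (map f w)
    f-adjacent w mw =
      subst (λ v → Edge (H [ Part t ]) v (map f w)) (retract∘section (retracts t) w)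
        (preserves r (moved-adjacent k (map i w) (section-moved w mw)))

    f-idem : ∀ h → map f (map f h) ≡ map f h
    -- If `f` moves `f h`, it also moves `h`, so the two moved vertices coincide; applying `f` to
    -- that equality gives a contradiction.
    f-idem h = decidable-stable (refinement-≟ _≟_ _ _) λ moved →
      moved (cong (map f) (f-moves≤1 (map f h) h moved (moved ∘ cong (map f))))

    open Fixed _≟_ (Part? t) f f-idem public

    trace : Trace k
    trace = record
      { Part     = Fix
      ; Part?    = Fix?
      ; retracts = record
        { section         = down k ∘ʰ (i ∘ʰ include)
        ; retract         = restrict ∘ʰ (r ∘ʰ up k)
        -- The inner composite `r ∘ up k ∘ down k ∘ i` is `f` by definition, and `f` fixes the
        -- vertices of `Fix`.
        ; retract∘section = λ h →
            trans (cong (map restrict) (Fix⇒fixed (map include h) (proof h))) (restrict∘include h)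
        }
      }

    trace-folds : FoldsOnto H (Part t) (Part trace)
    trace-folds = folds f-moves≤1 f-adjacent

  level : Vertex H → ℕ
  level h = proj₁ (union (map (section ret) h))

  top : ℕ
  top = proj₁ (finite-bounded fin level)

  section∈X : ∀ {k} → top ≤ k → ∀ h → X k (map (section ret) h)
  section∈X top≤k h =
    X-mono (≤-trans (proj₂ (finite-bounded fin level) h) top≤k) (proj₂ (union _))

  whole : ∀ k → .(top ≤ k) → Trace k
  whole k top≤k = record
    { Part     = U
    ; Part?    = λ _ → yes tt
    ; retracts = record
      { section = record
        { map       = λ h → map (section ret) (value h) ⸴ irr (section∈X top≤k (value h))
        ; preserves = preserves (section ret)
        }
      ; retract = record
        { map       = λ v → map (retract ret) (value v) ⸴ irr tt
        ; preserves = preserves (retract ret)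
        }
      ; retract∘section = λ h → value-injective (retract∘section ret (value h))
      }
    }

  -- `j` counts the descents, which begin with the whole of H at level `k + j`. The bound is
  -- irrelevant so that traces built from different proofs of it agree definitionally, as
  -- `traceFrom-folds` requires.
  traceFrom : ∀ j k → .(top ≤ k + j) → Trace k
  traceFrom zero    k le = whole k (≤-trans le (≤-reflexive (+-identityʳ k)))
  traceFrom (suc j) k le =
    Descent.trace (traceFrom j (suc k) (≤-trans le (≤-reflexive (+-suc k j))))

  traceAt : ∀ k → Trace k
  traceAt k = traceFrom (top ∸ k) k (m≤n+m∸n top k)

  Z : ℕ → Pred (Vertex H) 0ℓ
  Z k = Part (traceAt k)

  -- The counts `top ∸ k` and `top ∸ suc k` are generalised to variables, so that the equation
  -- between them can be matched with `refl`.
  traceFrom-folds : ∀ j k .(le : top ≤ k + j) j′ .(le′ : top ≤ suc k + j′) → pred j ≡ j′ →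
                    FoldsOnto H (Part (traceFrom j′ (suc k) le′)) (Part (traceFrom j k le))
  -- Here `k` is at or beyond `top`, and both parts are all of H.
  traceFrom-folds zero    k le _ le′ refl = FoldsOnto-refl
  traceFrom-folds (suc j) k le _ le′ refl = Descent.trace-folds (traceFrom j (suc k) le′)

  Z-folds : ∀ k → FoldsOnto H (Z (suc k)) (Z k)
  Z-folds k = traceFrom-folds (top ∸ k) k _ _ _ (pred[m∸n]≡m∸[1+n] top k)

  Z-top : ∀ h → Z top h
  Z-top h = traceFrom-top (top ∸ top) (m≤n+m∸n top top) (n∸n≡0 top)
    where
    traceFrom-top : ∀ j .(le : top ≤ top + j) → j ≡ 0 → Part (traceFrom j top le) h
    traceFrom-top _ _ refl = tt

  -- A retract of a one-vertex graph: the retraction supplies a vertex, and injectivity of the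
  -- section makes it unique.
  Z-start : HasSize (Vertex (H [ Z 0 ])) 1
  Z-start = singleton-size (map (retract R) (Inverse.from start zero)) λ x y →
    trans (sym (retract∘section R x))
      (trans (cong (map (retract R)) (size≤1⇒subsingleton (s≤s z≤n) start _ _))
        (retract∘section R y))
    where R = retracts (traceAt 0)

  Z-finite : ∀ k → Finite (Vertex (H [ Z k ]))
  Z-finite k = refinement-finite fin (Part? (traceAt k))

  sociable : Sociable H
  sociable = record
    { countable = inj₁ fin
    ; X         = Z
    ; finite    = Z-finite
    ; union     = λ h → top , Z-top h
    ; start     = Z-start
    ; monotone  = λ k → FoldsOnto.shrinks (Z-folds k)
    ; step      = Z-step
    ; p         = λ k → FoldsOnto.fold (Z-folds k)
    -- The inclusion of the singleton in the complement, taken at `w` itself, says that `w` is new.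
    ; adjacent  = λ k w new → FoldsOnto.adjacent (Z-folds k) w (proj₂ new refl)
    }
    where
    Z-step : ∀ k → ∃[ m ] m ≤ 1 ×
             HasSize (Refinement (Vertex (H [ Z (suc k) ])) (∁ (Z k ∘ value))) m
    Z-step k with m , size ← refinement-finite (Z-finite (suc k)) (¬? ∘ Part? (traceAt k) ∘ value) =
      m , subsingleton-size size subsingleton , size
      where
      subsingleton : ∀ (x y : Refinement (Vertex (H [ Z (suc k) ])) (∁ (Z k ∘ value))) → x ≡ y
      subsingleton (x ⸴ irr ∉x) (y ⸴ irr ∉y) =
        value-injective (FoldsOnto.removes≤1 (Z-folds k) x y
          (λ z → ⊥-elim-irr (∉x z)) (λ z → ⊥-elim-irr (∉y z)))

retraction⇒retractOf : {Y : Pred (Vertex G) 0ℓ} → Retraction G Y → (G [ Y ]) RetractOf G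
retraction⇒retractOf r = record
  { section         = record { map = value ; preserves = λ e → e }
  ; retract         = hom r
  ; retract∘section = identity r
  }

theorem6p5 : (G : Graph) → Sociable G →
    (Y : Pred (Vertex G) 0ℓ) → Finite (Vertex (G [ Y ])) → Retraction G Y →
    Sociable (G [ Y ])
theorem6p5 G soc Y fin r = FiniteRetract.sociable soc fin (retraction⇒retractOf r)
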